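{- Let $D$ be a digraph on $n$ vertices and let $k=\max(\mathrm{kp}(D),2)$, where $\mathrm{kp}(D)$ is the kernel-perfect number of $D$. Then: \begin{itemize} \item[I.] If $D$ is sink-free, then $D$ has a quasi-kernel of size at most $\left(1-\frac1k\right)n$. \item[II.] $D$ has a quasi-kernel of size at most $n-\frac{s}{k}$, where $s$ is the number of sources of $D$ that are not sinks of $D$. \item[III.] $D$ has a quasi-kernel $Q$ such that $|N^-[Q]|\ge \frac{n}{k}$. \end{itemize}
   Context: Digraphs $D=(V(D),A(D))$ are finite, without loops or parallel arcs; a pair of opposite arcs $uv,vu$ (directed 2-cycle) is allowed. If $xy\in A(D)$, then $y$ is an out-neighbor of $x$ and $x$ is an in-neighbor of $y$. A sink is a vertex with no out-neighbors; a source is a vertex with no in-neighbors; a digraph is sink-free if it has no sinks. For vertices $u,v$, $\mathrm{dist}(u,v)\in\mathbb{Z}^{\ge 0}\cup\{\infty\}$ is the length of a shortest directed path from $u$ to $v$, and for $S\subseteq V(D)$, $\mathrm{dist}(u,S)=\min_{v\in S}\mathrm{dist}(u,v)$ (equal to $\infty$ if $S=\emptyset$). Define $N^-[S]=\{u\in V(D):\mathrm{dist}(u,S)\le 1\}$. A set of vertices is independent if there is no arc between any two of its vertices. A kernel of $D$ is an independent set $K\subseteq V(D)$ with $N^-[K]=V(D)$. A quasi-kernel of $D$ is an independent set $Q\subseteq V(D)$ such that $\mathrm{dist}(u,Q)\le 2$ for every $u\in V(D)$. A digraph is kernel-perfect if every induced subdigraph of it has a kernel; a vertex set $S\subseteq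 V(D)$ is called kernel-perfect if the induced subdigraph $D[S]$ is kernel-perfect. The kernel-perfect number $\mathrm{kp}(D)$ is the smallest $k$ such that $V(D)$ can be partitioned into $k$ kernel-perfect subsets. -}

module Defs where

open import Data.Fin.Base using (Fin)
open import Data.Fin.Properties using (_≟_; all?; any?)
open import Data.Fin.Subset using (Subset; _∈_; _⊆_; _∩_; Nonempty)
open import Data.Fin.Subset.Properties using (_∈?_; x∈p∩q⁺; x∈p∩q⁻)
open import Data.Nat.Base using (ℕ; zero; suc; _≤_; _<_; s≤s; s≤s⁻¹; _⊔_; NonZero; >-nonZero)
open import Data.Nat.Properties using (anyUpTo?; allUpTo?; ≤-trans; m≤n⊔m; n≤1+n)
open import Data.Product.Base using (∃; ∃-syntax; _×_; _,_; proj₁; proj₂)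
open import Data.Vec.Base using (Vec; []; _∷_; head; last; tabulate)
open import Data.Vec.Relation.Unary.All as All using (All)
open import Data.Vec.Relation.Unary.AllPairs using (allPairs?)
open import Data.Vec.Relation.Unary.Linked using (Linked; linked?)
open import Data.Vec.Relation.Unary.Unique.Propositional using (Unique)
open import Level using (0ℓ)
open import Relation.Binary.Core using (Rel)
open import Relation.Binary.PropositionalEquality using (_≡_)
open import Relation.Nullary using (¬_; Dec; does)
open import Relation.Nullary.Decidable using (map′; _×-dec_; ¬?)
import Relation.Binary.Definitions as B
open import Relation.Unary using (Pred; Decidable)

-- The vertex set is an arbitrary subset of a finite set Fin N of labels, so
-- that an induced subdigraph keeps the names of its vertices.  The number of
-- vertices is therefore ∣ V D ∣, not N.
record Digraph (N : ℕ) : Set₁ where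
  field
    V        : Subset N
    Arc      : Rel (Fin N) 0ℓ
    arc?     : B.Decidable Arc
    endpoints : ∀ {u v} → Arc u v → u ∈ V × v ∈ V
    loopless : ∀ {u} → ¬ Arc u u

open Digraph public

private
  variable
    N : ℕ

infix 8 _[_]

_[_] : Digraph N → Subset N → Digraph N
D [ S ] = record
  { V         = V D ∩ S
  ; Arc       = λ u v → Arc D u v × u ∈ S × v ∈ S
  ; arc?      = λ u v → arc? D u v ×-dec (u ∈? S ×-dec v ∈? S)
  ; endpoints = λ (a , u∈S , v∈S) →
      x∈p∩q⁺ (proj₁ (endpoints D a) , u∈S) , x∈p∩q⁺ (proj₂ (endpoints D a) , v∈S)
  ; loopless  = λ (a , _) → loopless D a
  }

subsetOf : {P : Pred (Fin N) 0ℓ} → Decidable P → Subset N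
subsetOf P? = tabulate (λ u → does (P? u))

Least : Pred ℕ 0ℓ → Pred ℕ 0ℓ
Least P d = P d × (∀ {e} → e < d → ¬ P e)

least? : {P : Pred ℕ 0ℓ} → Decidable P → Decidable (Least P)
least? P? d = P? d ×-dec allUpTo? (λ e → ¬? (P? e)) d

anyVec? : ∀ {m} {P : Pred (Vec (Fin N) m) 0ℓ} → Decidable P → Dec (∃ P)
anyVec? {m = zero}  P? = map′ ([] ,_) (λ { ([] , p) → p }) (P? [])
anyVec? {m = suc m} P? =
  map′ (λ (x , xs , p) → x ∷ xs , p) (λ { (x ∷ xs , p) → x , xs , p })
       (any? λ x → anyVec? λ xs → P? (x ∷ xs))

module _ (D : Digraph N) where

  Source Sink : Pred (Fin N) 0ℓ
  Source u = u ∈ V D × (∀ v → ¬ Arc D v u)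
  Sink   u = u ∈ V D × (∀ v → ¬ Arc D u v)

  source? : Decidable Source
  source? u = u ∈? V D ×-dec all? (λ v → ¬? (arc? D v u))

  sink? : Decidable Sink
  sink? u = u ∈? V D ×-dec all? (λ v → ¬? (arc? D u v))

  SinkFree : Set
  SinkFree = ∀ u → ¬ Sink u

  nonSinkSources : Subset N
  nonSinkSources = subsetOf (λ u → source? u ×-dec ¬? (sink? u))

  -- A directed path of length d from u to v, given by its d + 1 vertices.
  IsPath : Fin N → Fin N → ∀ {d} → Vec (Fin N) (suc d) → Set
  IsPath u v xs =
    head xs ≡ u × last xs ≡ v × All (_∈ V D) xs × Linked (Arc D) xs × Unique xs

  Path : Fin N → Fin N → Pred ℕ 0ℓ
  Path u v d = ∃[ xs ] IsPath u v {d} xs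

  path? : ∀ u v → Decidable (Path u v)
  path? u v d = anyVec? λ xs →
    head xs ≟ u ×-dec last xs ≟ v ×-dec All.all? (_∈? V D) xs
      ×-dec linked? (arc? D) xs ×-dec allPairs? (λ x y → ¬? (x ≟ y)) xs

  -- Distances are the graphs of partial functions to ℕ: dist(u,v) = ∞ means
  -- that Dist u v d holds for no d, and likewise for DistTo.
  Dist : Fin N → Fin N → Pred ℕ 0ℓ
  Dist u v = Least (Path u v)

  DistTo : Fin N → Subset N → Pred ℕ 0ℓ
  DistTo u S = Least (λ d → ∃[ v ] v ∈ S × Dist u v d)

  distTo? : ∀ u S → Decidable (DistTo u S)
  distTo? u S = least? λ d → any? λ v → v ∈? S ×-dec least? (path? u v) d

  -- dist(u,S) ≤ m
  DistTo≤ : Fin N → Subset N → Pred ℕ 0ℓ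
  DistTo≤ u S m = ∃[ d ] d ≤ m × DistTo u S d

  distTo≤? : ∀ u S → Decidable (DistTo≤ u S)
  distTo≤? u S m =
    map′ (λ (d , d<1+m , p) → d , s≤s⁻¹ d<1+m , p) (λ (d , d≤m , p) → d , s≤s d≤m , p)
         (anyUpTo? (distTo? u S) (suc m))

  N⁻[_] : Subset N → Subset N
  N⁻[ S ] = subsetOf (λ u → u ∈? V D ×-dec distTo≤? u S 1)

  Independent : Pred (Subset N) 0ℓ
  Independent S = ∀ {u v} → u ∈ S → v ∈ S → ¬ Arc D u v

  Kernel : Pred (Subset N) 0ℓ
  Kernel K = K ⊆ V D × Independent K × N⁻[ K ] ≡ V D

  QuasiKernel : Pred (Subset N) 0ℓ
  QuasiKernel Q = Q ⊆ V D × Independent Q × (∀ {u} → u ∈ V D → DistTo≤ u Q 2)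

KernelPerfect : Digraph N → Set
KernelPerfect D = ∀ S → S ⊆ V D → ∃[ K ] Kernel (D [ S ]) K

module _ (D : Digraph N) where

  record KernelPerfectPartition (k : ℕ) : Set where
    field
      part          : Fin k → Subset N
      part⊆V        : ∀ i → part i ⊆ V D
      nonempty      : ∀ i → Nonempty (part i)
      disjoint      : ∀ {i j u} → u ∈ part i → u ∈ part j → i ≡ j
      cover         : ∀ {u} → u ∈ V D → ∃[ i ] u ∈ part i
      kernelPerfect : ∀ i → KernelPerfect (D [ part i ])

  -- kp(D) = k
  KernelPerfectNumber : Pred ℕ 0ℓ
  KernelPerfectNumber = Least KernelPerfectPartition

instance
  m⊔2-nonZero : ∀ {m} → NonZero (m ⊔ 2)
  m⊔2-nonZero {m} = >-nonZero (≤-trans (n≤1+n 1) (m≤n⊔m m 2))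

{-# OPTIONS --safe #-}
module Submission where

-- The three bounds rest on one construction.  Let T be a kernel-perfect set of
-- vertices, A a quasi-kernel of the subdigraph on V(D) minus N⁻[T], and K a
-- kernel of the set of vertices of T without out-neighbour in A.  Then
-- Q = A ∪ K is a quasi-kernel of D; it satisfies T ⊆ N⁻[Q], and every vertex
-- of Q with an out-neighbour in T lies in T (extend, absorber).  With T a
-- single vertex this also yields, by induction, the existence of A.
--
-- Write V₀, V₁, … for the classes of a partition of V(D) into k kernel-perfect
-- sets; some may be empty, since k is at least 2 while kp(D) may be smaller.
-- Each bound follows by pigeonhole (cover⇒large) from a family of k sets that
-- covers what has to be counted.
--
-- Closed in-neighbourhoods: take T = Vᵢ for a largest class Vᵢ.
--
-- Sources: every source that is not a sink has an out-neighbour in some Vᵢ, so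
-- for some i at least s / k sources do.  Take Q for T = Vᵢ and delete these
-- sources from it.  Nothing reaches a source, and a deleted source still has
-- distance at most 2 to the rest of Q because Vᵢ ⊆ N⁻[Q] (dropSources).
--
-- Sink-free digraphs: it suffices to find quasi-kernels Q₀, Q₁, … , one for
-- each class, without a common vertex, for then the complements of the Qᵢ
-- cover V(D).  Call a vertex bad if all its out-neighbours lie in its own
-- class.  For each i other than 0 move a kernel of the set of bad vertices of
-- Vᵢ to V₀.  The moved vertices are sinks in the enlarged V₀, so it remains
-- kernel-perfect, and every bad vertex now lies in V₀ (recolour).  Let M be a
-- kernel of the set of bad vertices and take the quasi-kernels belonging to
-- T₀ = V₀ minus M and Tᵢ = Vᵢ ∪ M for the other i.  A vertex u is missing from
-- Qᵢ as soon as it lies outside Tᵢ and has an out-neighbour in Tᵢ.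
-- This applies with i = 0 if u lies in M, with i = 1 if u is bad but not in M,
-- and with i the class of v if u has an out-neighbour v in another class and v
-- is not in M.  There remain the vertices u of Vⱼ, j different from 0, with an
-- out-neighbour in M: a third class serves if k ≥ 3.  If k = 2, then N⁻[T₁] is
-- all of V(D), and for Q₁ one can take a kernel of T₁ that contains M
-- (noCommonVertex).

open import Data.Fin.Subset using (∣_∣)
open import Data.Integer.Base using (+_)
open import Data.Nat.Base using (ℕ; _⊔_)
open import Data.Product.Base using (∃-syntax; _×_)
open import Data.Rational.Base using (_/_; 1ℚ; _-_; _*_; _≤_; _≥_)
open import Defs

open import Data.Empty using (⊥-elim)
open import Data.Fin.Base using (Fin; zero; suc; inject≤; fromℕ<)
open import Data.Fin.Properties using (_≟_; all?; any?; inject≤-injective)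
open import Data.Fin.Subset
  using (Subset; inside; outside; _∈_; _∉_; _⊆_; _⊂_; _∩_; _∪_; _─_; ⊥; ⁅_⁆)
open import Data.Fin.Subset.Induction using (⊂-wellFounded; Acc; acc)
open import Data.Fin.Subset.Properties
  using ( _∈?_; nonempty?; ∉⊥; x∈⁅x⁆; x∈⁅y⁆⇒x≡y; ⊆-antisym; p⊆q⇒∣p∣≤∣q∣
        ; x∈p∩q⁺; p∩q⊆p; p∩q⊆q; x∈p∪q⁺; x∈p∪q⁻; p─q⊆p; x∈p∧x∉q⇒x∈p─q)
import Data.Integer.Base as ℤ
import Data.Integer.Properties as ℤ
import Data.Nat.Base as ℕ
import Data.Nat.Properties as ℕ
open import Data.Nat.Base using (zero; suc; z≤n; s≤s; NonZero)
open import Data.Product.Base using (∃; _,_; proj₁; proj₂)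
open import Data.Rational.Base using (toℚᵘ)
open import Data.Rational.Properties
  using ( toℚᵘ-cancel-≤; toℚᵘ-injective; toℚᵘ-fromℚᵘ; toℚᵘ-homo-+; toℚᵘ-homo-*; neg-antimono-≤
        ; +-monoʳ-≤; *-distribʳ-+; neg-distribˡ-*; *-identityˡ)
import Data.Rational.Base as ℚ
import Data.Rational.Properties as ℚ
open import Data.Rational.Unnormalised.Base as ℚᵘ using (mkℚᵘ; *≤*; *≡*)
import Data.Rational.Unnormalised.Properties as ℚᵘ
open import Data.Sum.Base using (_⊎_; inj₁; inj₂; [_,_]′)
open import Data.Vec.Base using ([]; _∷_; here; there)
open import Data.Vec.Properties using (lookup∘tabulate; lookup⇒[]=; []=⇒lookup)
open import Data.Vec.Relation.Unary.All using ([]; _∷_)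
open import Data.Vec.Relation.Unary.AllPairs using ([]; _∷_)
open import Data.Vec.Relation.Unary.Linked using ([-]; _∷_)
open import Function.Base using (_∘_; case_of_)
open import Level using (0ℓ)
open import Relation.Binary.PropositionalEquality
  using (_≡_; _≢_; refl; sym; trans; cong; cong₂; subst; module ≡-Reasoning)
open import Relation.Nullary using (¬_; Dec; does; yes; no; contradiction)
open import Relation.Nullary.Decidable
  using (dec-true; _×-dec_; _⊎-dec_; _→-dec_; ¬?; decidable-stable)
open import Relation.Unary using (Pred; Decidable)

private
  variable
    N k : ℕ

-- Finite sets and their sizes

∈-subsetOf⁺ : {P : Pred (Fin N) 0ℓ} (P? : Decidable P) {u : Fin N} → P u → u ∈ subsetOf P?
∈-subsetOf⁺ P? {u} p =
  lookup⇒[]= u _ (trans (lookup∘tabulate (does ∘ P?) u) (dec-true (P? u) p))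

∈-subsetOf⁻ : {P : Pred (Fin N) 0ℓ} (P? : Decidable P) {u : Fin N} → u ∈ subsetOf P? → P u
∈-subsetOf⁻ P? {u} u∈ with P? u | trans (sym (lookup∘tabulate (does ∘ P?) u)) ([]=⇒lookup u∈)
... | yes p | _  = p
... | no _  | ()

x∈p─q⇒x∉q : (p q : Subset N) {x : Fin N} → x ∈ p ─ q → x ∉ q
x∈p─q⇒x∉q (inside ∷ p) (outside ∷ q) here ()
x∈p─q⇒x∉q (_ ∷ p) (_ ∷ q) (there x∈) (there x∈q) = x∈p─q⇒x∉q p q x∈ x∈q

∣p∩q∣+∣p─q∣≡∣p∣ : (p q : Subset N) → ∣ p ∩ q ∣ ℕ.+ ∣ p ─ q ∣ ≡ ∣ p ∣
∣p∩q∣+∣p─q∣≡∣p∣ []            []            = refl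
∣p∩q∣+∣p─q∣≡∣p∣ (outside ∷ p) (outside ∷ q) = ∣p∩q∣+∣p─q∣≡∣p∣ p q
∣p∩q∣+∣p─q∣≡∣p∣ (outside ∷ p) (inside ∷ q)  = ∣p∩q∣+∣p─q∣≡∣p∣ p q
∣p∩q∣+∣p─q∣≡∣p∣ (inside ∷ p)  (inside ∷ q)  = cong suc (∣p∩q∣+∣p─q∣≡∣p∣ p q)
∣p∩q∣+∣p─q∣≡∣p∣ (inside ∷ p)  (outside ∷ q) =
  trans (ℕ.+-suc ∣ p ∩ q ∣ ∣ p ─ q ∣) (cong suc (∣p∩q∣+∣p─q∣≡∣p∣ p q))

q⊆p⇒∣q∣+∣p─q∣≡∣p∣ : {p q : Subset N} → q ⊆ p → ∣ q ∣ ℕ.+ ∣ p ─ q ∣ ≡ ∣ p ∣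
q⊆p⇒∣q∣+∣p─q∣≡∣p∣ {p = p} {q} q⊆p =
  trans (cong (λ r → ∣ r ∣ ℕ.+ ∣ p ─ q ∣) (sym p∩q≡q)) (∣p∩q∣+∣p─q∣≡∣p∣ p q)
  where
  p∩q≡q : p ∩ q ≡ q
  p∩q≡q = ⊆-antisym (p∩q⊆q p q) (λ x∈q → x∈p∩q⁺ (q⊆p x∈q , x∈q))

∣p∣≤∣q∣+∣p─q∣ : (p q : Subset N) → ∣ p ∣ ℕ.≤ ∣ q ∣ ℕ.+ ∣ p ─ q ∣
∣p∣≤∣q∣+∣p─q∣ p q = begin
  ∣ p ∣                      ≡⟨ ∣p∩q∣+∣p─q∣≡∣p∣ p q ⟨
  ∣ p ∩ q ∣ ℕ.+ ∣ p ─ q ∣    ≤⟨ ℕ.+-monoˡ-≤ ∣ p ─ q ∣ (p⊆q⇒∣p∣≤∣q∣ (p∩q⊆q p q)) ⟩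
  ∣ q ∣ ℕ.+ ∣ p ─ q ∣        ∎
  where open ℕ.≤-Reasoning

-- If k ≥ 1 sets cover X, then one of them has at least ∣ X ∣ / k elements.
cover⇒large : (X : Subset N) (Z : Fin k → Subset N) .{{_ : NonZero k}} →
              (∀ {u} → u ∈ X → ∃[ i ] u ∈ Z i) → ∃[ i ] ∣ X ∣ ℕ.≤ k ℕ.* ∣ Z i ∣
cover⇒large {k = suc zero} X Z cover = zero , (begin
  ∣ X ∣            ≤⟨ p⊆q⇒∣p∣≤∣q∣ X⊆Z₀ ⟩
  ∣ Z zero ∣       ≡⟨ ℕ.*-identityˡ _ ⟨
  1 ℕ.* ∣ Z zero ∣ ∎)
  where
  open ℕ.≤-Reasoning
  X⊆Z₀ : X ⊆ Z zero
  X⊆Z₀ u∈X with cover u∈X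
  ... | zero , u∈Z₀ = u∈Z₀
cover⇒large {k = suc (suc k)} X Z cover = larger (cover⇒large X′ (Z ∘ suc) cover′)
  where
  X′ = X ─ Z zero

  cover′ : ∀ {u} → u ∈ X′ → ∃[ i ] u ∈ Z (suc i)
  cover′ u∈X′ with cover (p─q⊆p X (Z zero) u∈X′)
  ... | zero  , u∈Z₀ = contradiction u∈Z₀ (x∈p─q⇒x∉q X (Z zero) u∈X′)
  ... | suc i , u∈Zᵢ = i , u∈Zᵢ

  larger : (∃[ i ] ∣ X′ ∣ ℕ.≤ suc k ℕ.* ∣ Z (suc i) ∣) →
           ∃[ i ] ∣ X ∣ ℕ.≤ suc (suc k) ℕ.* ∣ Z i ∣
  larger (i , X′≤) with ℕ.≤-total ∣ Z zero ∣ ∣ Z (suc i) ∣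
  ... | inj₁ Z₀≤Zᵢ = suc i , ℕ.≤-trans (∣p∣≤∣q∣+∣p─q∣ X (Z zero)) (ℕ.+-mono-≤ Z₀≤Zᵢ X′≤)
  ... | inj₂ Zᵢ≤Z₀ = zero , ℕ.≤-trans (∣p∣≤∣q∣+∣p─q∣ X (Z zero))
    (ℕ.+-monoʳ-≤ ∣ Z zero ∣ (ℕ.≤-trans X′≤ (ℕ.*-monoʳ-≤ (suc k) Zᵢ≤Z₀)))

-- Distances at most two

-- A decidable property of m holds at a least number, which is at most m.
least-below : {P : Pred ℕ 0ℓ} → Decidable P → ∀ m → P m → ∃[ d ] d ℕ.≤ m × Least P d
least-below P? zero p = zero , z≤n , p , λ ()
least-below P? (suc m) p with P? zero
... | yes p₀ = zero , z≤n , p₀ , λ ()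
... | no ¬p₀ =
  let d , d≤m , q , minimal = least-below (P? ∘ suc) m p in
  suc d , s≤s d≤m , q , λ { {zero} _ → ¬p₀ ; {suc e} (s≤s e<d) → minimal e<d }

module _ (D : Digraph N) where

  -- u has an out-neighbour in S.
  Hits : Subset N → Pred (Fin N) 0ℓ
  Hits S u = ∃[ v ] v ∈ S × Arc D u v

  -- u has distance at most 1, respectively at most 2, to S, expressed by walks,
  -- whose vertices need not be distinct.
  Reach₁ Reach₂ : Subset N → Pred (Fin N) 0ℓ
  Reach₁ S u = u ∈ S ⊎ Hits S u
  Reach₂ S u = Reach₁ S u ⊎ ∃[ v ] Arc D u v × Reach₁ S v

  hits? : ∀ S → Decidable (Hits S)
  hits? S u = any? λ v → v ∈? S ×-dec arc? D u v

  reach₁? : ∀ S → Decidable (Reach₁ S)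
  reach₁? S u = u ∈? S ⊎-dec hits? S u

  path⇒distTo≤ : ∀ {u v S} m → v ∈ S → Path D u v m → DistTo≤ D u S m
  path⇒distTo≤ {u} {v} {S} m v∈S path =
    let d , d≤m , dist = least-below (path? D u v) m path
        e , e≤d , distTo = least-below toSome? d (v , v∈S , dist)
    in e , ℕ.≤-trans e≤d d≤m , distTo
    where
    toSome? : Decidable (λ d → ∃[ w ] w ∈ S × Dist D u w d)
    toSome? d = any? λ w → w ∈? S ×-dec least? (path? D u w) d

  distTo≤-mono : ∀ {u S m m′} → m ℕ.≤ m′ → DistTo≤ D u S m → DistTo≤ D u S m′
  distTo≤-mono m≤m′ (d , d≤m , dist) = d , ℕ.≤-trans d≤m m≤m′ , dist

  arc-≢ : ∀ {u v} → Arc D u v → u ≢ v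
  arc-≢ a refl = loopless D a

  reach₁⇒distTo≤1 : ∀ {u S} → u ∈ V D → Reach₁ S u → DistTo≤ D u S 1
  reach₁⇒distTo≤1 {u} u∈V (inj₁ u∈S) = distTo≤-mono z≤n
    (path⇒distTo≤ 0 u∈S (u ∷ [] , refl , refl , u∈V ∷ [] , [-] , [] ∷ []))
  reach₁⇒distTo≤1 {u} u∈V (inj₂ (v , v∈S , a)) = path⇒distTo≤ 1 v∈S
    (u ∷ v ∷ [] , refl , refl , u∈V ∷ proj₂ (endpoints D a) ∷ [] , a ∷ [-]
    , (arc-≢ a ∷ []) ∷ [] ∷ [])

  reach₂⇒distTo≤2 : ∀ {u S} → u ∈ V D → Reach₂ S u → DistTo≤ D u S 2
  reach₂⇒distTo≤2 u∈V (inj₁ r) = distTo≤-mono (s≤s z≤n) (reach₁⇒distTo≤1 u∈V r)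
  reach₂⇒distTo≤2 u∈V (inj₂ (v , a , inj₁ v∈S)) =
    distTo≤-mono (s≤s z≤n) (reach₁⇒distTo≤1 u∈V (inj₂ (v , v∈S , a)))
  reach₂⇒distTo≤2 {u} u∈V (inj₂ (v , a , inj₂ (w , w∈S , b))) with u ≟ w
  ... | yes refl = distTo≤-mono (s≤s z≤n) (reach₁⇒distTo≤1 u∈V (inj₁ w∈S))
  ... | no u≢w = path⇒distTo≤ 2 w∈S
    ( u ∷ v ∷ w ∷ [] , refl , refl
    , u∈V ∷ proj₂ (endpoints D a) ∷ proj₂ (endpoints D b) ∷ []
    , a ∷ b ∷ [-]
    , (arc-≢ a ∷ u≢w ∷ []) ∷ (arc-≢ b ∷ []) ∷ [] ∷ [])

  distTo≤1⇒reach₁ : ∀ {u S} → DistTo≤ D u S 1 → Reach₁ S u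
  distTo≤1⇒reach₁ (zero , _ , (v , v∈S , (_ ∷ [] , refl , refl , _) , _) , _) = inj₁ v∈S
  distTo≤1⇒reach₁
    (suc zero , _ , (v , v∈S , (_ ∷ _ ∷ [] , refl , refl , _ , a ∷ [-] , _) , _) , _) =
    inj₂ (v , v∈S , a)
  distTo≤1⇒reach₁ (suc (suc _) , s≤s () , _)

  ∈N⁻⁺ : ∀ {u S} → u ∈ V D → Reach₁ S u → u ∈ N⁻[_] D S
  ∈N⁻⁺ {S = S} u∈V r =
    ∈-subsetOf⁺ (λ u → u ∈? V D ×-dec distTo≤? D u S 1) (u∈V , reach₁⇒distTo≤1 u∈V r)

  ∈N⁻⁻ : ∀ {u S} → u ∈ N⁻[_] D S → Reach₁ S u
  ∈N⁻⁻ {S = S} u∈ =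
    distTo≤1⇒reach₁ (proj₂ (∈-subsetOf⁻ (λ u → u ∈? V D ×-dec distTo≤? D u S 1) u∈))

  kernel⇒reach₁ : ∀ {K u} → Kernel D K → u ∈ V D → Reach₁ K u
  kernel⇒reach₁ {u = u} (_ , _ , N⁻[K]≡V) u∈V = ∈N⁻⁻ (subst (u ∈_) (sym N⁻[K]≡V) u∈V)

-- Kernels and kernel-perfect vertex sets

module _ (D : Digraph N) where

  -- K is a kernel of the subdigraph induced by S.
  KernelIn : Subset N → Subset N → Set
  KernelIn S K = K ⊆ S × Independent D K × (∀ {u} → u ∈ S → Reach₁ D K u)

  -- Every subset of S induces a subdigraph that has a kernel.
  Perfect : Subset N → Set
  Perfect S = ∀ S′ → S′ ⊆ S → ∃[ K ] KernelIn S′ K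

  perfect-⊆ : ∀ {S T} → S ⊆ T → Perfect T → Perfect S
  perfect-⊆ S⊆T perfect S′ S′⊆S = perfect S′ (S⊆T ∘ S′⊆S)

  independent⇒perfect : ∀ {S} → Independent D S → Perfect S
  independent⇒perfect indep S′ S′⊆S =
    S′ , (λ u∈ → u∈) , (λ u∈ v∈ → indep (S′⊆S u∈) (S′⊆S v∈)) , inj₁

  -- If L is independent and sends no arc to S, the vertices of L are sinks in
  -- the subdigraph induced by S ∪ L; hence every S′ ⊆ S ∪ L has a kernel that
  -- contains S′ ∩ L.
  kernel-∪-sinks : ∀ {S L} → Perfect S → Independent D L →
                   (∀ {u v} → u ∈ L → v ∈ S → ¬ Arc D u v) →
                   ∀ {S′} → S′ ⊆ S ∪ L → ∃[ K ] KernelIn S′ K × S′ ∩ L ⊆ K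
  kernel-∪-sinks {S} {L} perfect indep L↛S {S′} S′⊆ =
    K⁺ , (K⁺⊆S′ , indepK⁺ , coverK⁺) , x∈p∪q⁺ ∘ inj₁
    where
    L′ = S′ ∩ L

    inR? : Decidable (λ u → u ∈ S′ × u ∉ L × ¬ Hits D L′ u)
    inR? u = u ∈? S′ ×-dec ¬? (u ∈? L) ×-dec ¬? (hits? D L′ u)

    R = subsetOf inR?

    R⊆S : R ⊆ S
    R⊆S u∈R with ∈-subsetOf⁻ inR? u∈R
    ... | u∈S′ , u∉L , _ with x∈p∪q⁻ S L (S′⊆ u∈S′)
    ...   | inj₁ u∈S = u∈S
    ...   | inj₂ u∈L = contradiction u∈L u∉L

    kernelR = perfect R R⊆S
    K = proj₁ kernelR
    K⊆R = proj₁ (proj₂ kernelR)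
    indepK = proj₁ (proj₂ (proj₂ kernelR))
    coverK = proj₂ (proj₂ (proj₂ kernelR))
    K⁺ = L′ ∪ K

    inK : ∀ {u} → u ∈ K → u ∈ S′ × u ∉ L × ¬ Hits D L′ u
    inK u∈K = ∈-subsetOf⁻ inR? (K⊆R u∈K)

    K⊆S : K ⊆ S
    K⊆S u∈K = R⊆S (K⊆R u∈K)

    K⁺⊆S′ : K⁺ ⊆ S′
    K⁺⊆S′ u∈ with x∈p∪q⁻ L′ K u∈
    ... | inj₁ u∈L′ = p∩q⊆p S′ L u∈L′
    ... | inj₂ u∈K  = proj₁ (inK u∈K)

    indepK⁺ : Independent D K⁺
    indepK⁺ {u} {v} u∈ v∈ a with x∈p∪q⁻ L′ K u∈ | x∈p∪q⁻ L′ K v∈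
    ... | inj₁ u∈L′ | inj₁ v∈L′ = indep (p∩q⊆q S′ L u∈L′) (p∩q⊆q S′ L v∈L′) a
    ... | inj₁ u∈L′ | inj₂ v∈K  = L↛S (p∩q⊆q S′ L u∈L′) (K⊆S v∈K) a
    ... | inj₂ u∈K  | inj₁ v∈L′ = proj₂ (proj₂ (inK u∈K)) (v , v∈L′ , a)
    ... | inj₂ u∈K  | inj₂ v∈K  = indepK u∈K v∈K a

    coverK⁺ : ∀ {u} → u ∈ S′ → Reach₁ D K⁺ u
    coverK⁺ {u} u∈S′ with u ∈? L | hits? D L′ u
    ... | yes u∈L | _ = inj₁ (x∈p∪q⁺ (inj₁ (x∈p∩q⁺ (u∈S′ , u∈L))))
    ... | no _    | yes (v , v∈L′ , a) = inj₂ (v , x∈p∪q⁺ (inj₁ v∈L′) , a)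
    ... | no u∉L  | no ¬hits with coverK (∈-subsetOf⁺ inR? (u∈S′ , u∉L , ¬hits))
    ...   | inj₁ u∈K = inj₁ (x∈p∪q⁺ (inj₂ u∈K))
    ...   | inj₂ (v , v∈K , a) = inj₂ (v , x∈p∪q⁺ (inj₂ v∈K) , a)

  perfect-∪-sinks : ∀ {S L} → Perfect S → Independent D L →
                    (∀ {u v} → u ∈ L → v ∈ S → ¬ Arc D u v) → Perfect (S ∪ L)
  perfect-∪-sinks perfect indep L↛S S′ S′⊆ =
    let K , kernel , _ = kernel-∪-sinks perfect indep L↛S S′⊆ in K , kernel

  kernelPerfect⇒perfect : ∀ {P} → P ⊆ V D → KernelPerfect (D [ P ]) → Perfect P
  kernelPerfect⇒perfect {P} P⊆V kp S S⊆P = K , K⊆S , indep , near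
    where
    E = (D [ P ]) [ S ]

    S⊆V∩P : S ⊆ V D ∩ P
    S⊆V∩P u∈S = x∈p∩q⁺ (P⊆V (S⊆P u∈S) , S⊆P u∈S)

    K = proj₁ (kp S S⊆V∩P)

    kernel : Kernel E K
    kernel = proj₂ (kp S S⊆V∩P)

    K⊆S : K ⊆ S
    K⊆S u∈K = p∩q⊆q (V D ∩ P) S (proj₁ kernel u∈K)

    indep : Independent D K
    indep u∈K v∈K a = proj₁ (proj₂ kernel) u∈K v∈K
      ((a , S⊆P (K⊆S u∈K) , S⊆P (K⊆S v∈K)) , K⊆S u∈K , K⊆S v∈K)

    near : ∀ {u} → u ∈ S → Reach₁ D K u
    near u∈S = [ inj₁ , (λ (v , v∈K , (a , _) , _) → inj₂ (v , v∈K , a)) ]′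
      (kernel⇒reach₁ E kernel (x∈p∩q⁺ (S⊆V∩P u∈S , u∈S)))

-- Quasi-kernels that absorb a prescribed kernel-perfect set

module _ (D : Digraph N) where

  -- Q is a quasi-kernel relative to U: an independent subset of U to which
  -- every vertex of U has distance at most 2 in D.
  record QuasiKernelIn (U Q : Subset N) : Set where
    field
      sub   : Q ⊆ U
      indep : Independent D Q
      reach : ∀ {u} → u ∈ U → Reach₂ D Q u

  -- Q is a quasi-kernel relative to U with T ⊆ N⁻[Q] that contains no vertex
  -- outside T with an out-neighbour in T.
  record Absorber (U T Q : Subset N) : Set where
    field
      quasiKernel : QuasiKernelIn U Q
      near        : ∀ {u} → u ∈ T → Reach₁ D Q u
      avoid       : ∀ {u} → u ∈ Q → Hits D T u → u ∈ T

    open QuasiKernelIn quasiKernel public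

  -- Complete A by a kernel K of the set of vertices of T without out-neighbour
  -- in A.  No arc leads from A to T; all of T is within one step of A ∪ K, and
  -- so the vertices with an out-neighbour in T are within two.
  extend : ∀ {U T A} → T ⊆ U → Perfect D T →
           QuasiKernelIn (U ─ subsetOf (reach₁? D T)) A → ∃[ Q ] Absorber U T Q
  extend {U} {T} {A} T⊆U perfect quasiA
    with K , K⊆R , indepK , coverK ←
      perfect (T ─ subsetOf (hits? D A)) (p─q⊆p T (subsetOf (hits? D A))) =
    A ∪ K , record
      { quasiKernel = record { sub = sub ; indep = indep ; reach = reach }
      ; near = near ; avoid = avoid }
    where
    open QuasiKernelIn quasiA renaming (sub to A⊆; indep to indepA; reach to reachA)

    A↛T : ∀ {u} → u ∈ A → ¬ Reach₁ D T u
    A↛T u∈A r = x∈p─q⇒x∉q U (subsetOf (reach₁? D T)) (A⊆ u∈A) (∈-subsetOf⁺ (reach₁? D T) r)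

    K⊆T : K ⊆ T
    K⊆T u∈K = p─q⊆p T (subsetOf (hits? D A)) (K⊆R u∈K)

    K↛A : ∀ {u} → u ∈ K → ¬ Hits D A u
    K↛A u∈K h = x∈p─q⇒x∉q T (subsetOf (hits? D A)) (K⊆R u∈K) (∈-subsetOf⁺ (hits? D A) h)

    reach₁-∪ˡ : ∀ {u} → Reach₁ D A u → Reach₁ D (A ∪ K) u
    reach₁-∪ˡ (inj₁ u∈A) = inj₁ (x∈p∪q⁺ (inj₁ u∈A))
    reach₁-∪ˡ (inj₂ (v , v∈A , a)) = inj₂ (v , x∈p∪q⁺ (inj₁ v∈A) , a)

    sub : A ∪ K ⊆ U
    sub u∈ with x∈p∪q⁻ A K u∈
    ... | inj₁ u∈A = p─q⊆p U (subsetOf (reach₁? D T)) (A⊆ u∈A)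
    ... | inj₂ u∈K = T⊆U (K⊆T u∈K)

    indep : Independent D (A ∪ K)
    indep {u} {v} u∈ v∈ a with x∈p∪q⁻ A K u∈ | x∈p∪q⁻ A K v∈
    ... | inj₁ u∈A | inj₁ v∈A = indepA u∈A v∈A a
    ... | inj₁ u∈A | inj₂ v∈K = A↛T u∈A (inj₂ (v , K⊆T v∈K , a))
    ... | inj₂ u∈K | inj₁ v∈A = K↛A u∈K (v , v∈A , a)
    ... | inj₂ u∈K | inj₂ v∈K = indepK u∈K v∈K a

    near : ∀ {u} → u ∈ T → Reach₁ D (A ∪ K) u
    near {u} u∈T with hits? D A u
    ... | yes h = reach₁-∪ˡ (inj₂ h)
    ... | no ¬h with coverK (x∈p∧x∉q⇒x∈p─q u∈T (¬h ∘ ∈-subsetOf⁻ (hits? D A)))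
    ...   | inj₁ u∈K = inj₁ (x∈p∪q⁺ (inj₂ u∈K))
    ...   | inj₂ (v , v∈K , a) = inj₂ (v , x∈p∪q⁺ (inj₂ v∈K) , a)

    reach : ∀ {u} → u ∈ U → Reach₂ D (A ∪ K) u
    reach {u} u∈U with reach₁? D T u
    ... | yes (inj₁ u∈T) = inj₁ (near u∈T)
    ... | yes (inj₂ (v , v∈T , a)) = inj₂ (v , a , near v∈T)
    ... | no ¬r with reachA (x∈p∧x∉q⇒x∈p─q u∈U (¬r ∘ ∈-subsetOf⁻ (reach₁? D T)))
    ...   | inj₁ r = inj₁ (reach₁-∪ˡ r)
    ...   | inj₂ (v , a , r) = inj₂ (v , a , reach₁-∪ˡ r)

    avoid : ∀ {u} → u ∈ A ∪ K → Hits D T u → u ∈ T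
    avoid u∈ h with x∈p∪q⁻ A K u∈
    ... | inj₁ u∈A = contradiction (inj₂ h) (A↛T u∈A)
    ... | inj₂ u∈K = K⊆T u∈K

  -- The theorem of Chvátal and Lovász, by induction on U: a single vertex is
  -- kernel-perfect.
  quasiKernelIn : ∀ U → ∃[ Q ] QuasiKernelIn U Q
  quasiKernelIn U = go U (⊂-wellFounded U)
    where
    go : ∀ U → Acc _ U → ∃[ Q ] QuasiKernelIn U Q
    go U (acc smaller) with nonempty? U
    ... | no empty = ⊥ , record
      { sub   = λ u∈⊥ → contradiction u∈⊥ ∉⊥
      ; indep = λ u∈⊥ → contradiction u∈⊥ ∉⊥
      ; reach = λ u∈U → contradiction (_ , u∈U) empty }
    ... | yes (w , w∈U) =
      let A , quasi = go (U ─ R) (smaller U─R⊂U)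
          Q , absorber = extend w⊆U (independent⇒perfect D indep) quasi
      in Q , Absorber.quasiKernel absorber
      where
      R = subsetOf (reach₁? D ⁅ w ⁆)
      U─R⊂U : U ─ R ⊂ U
      U─R⊂U = p─q⊆p U R , w , w∈U
        , λ w∈ → x∈p─q⇒x∉q U R w∈ (∈-subsetOf⁺ (reach₁? D ⁅ w ⁆) (inj₁ (x∈⁅x⁆ w)))
      w⊆U : ⁅ w ⁆ ⊆ U
      w⊆U u∈ = subst (_∈ U) (sym (x∈⁅y⁆⇒x≡y w u∈)) w∈U
      indep : Independent D ⁅ w ⁆
      indep u∈ v∈ a = arc-≢ D a (trans (x∈⁅y⁆⇒x≡y w u∈) (sym (x∈⁅y⁆⇒x≡y w v∈)))

  absorber : ∀ {U T} → T ⊆ U → Perfect D T → ∃[ Q ] Absorber U T Q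
  absorber {U} {T} T⊆U perfect =
    extend T⊆U perfect (proj₂ (quasiKernelIn (U ─ subsetOf (reach₁? D T))))

  -- If T ⊆ U ⊆ N⁻[T], any kernel of T serves, which leaves a choice that the
  -- construction of extend does not.
  kernel⇒absorber : ∀ {U T K} → T ⊆ U → (∀ {u} → u ∈ U → Reach₁ D T u) →
                    KernelIn D T K → Absorber U T K
  kernel⇒absorber {U} T⊆U U⊆N⁻[T] (K⊆T , indepK , coverK) = record
    { quasiKernel = record { sub = T⊆U ∘ K⊆T ; indep = indepK ; reach = reach }
    ; near = coverK ; avoid = λ u∈K _ → K⊆T u∈K }
    where
    reach : ∀ {u} → u ∈ U → Reach₂ D _ u
    reach u∈U with U⊆N⁻[T] u∈U
    ... | inj₁ u∈T = inj₁ (coverK u∈T)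
    ... | inj₂ (v , v∈T , a) = inj₂ (v , a , coverK v∈T)

  quasiKernelIn⇒quasiKernel : ∀ {Q} → QuasiKernelIn (V D) Q → QuasiKernel D Q
  quasiKernelIn⇒quasiKernel quasi =
    sub , indep , λ u∈V → reach₂⇒distTo≤2 D u∈V (reach u∈V)
    where open QuasiKernelIn quasi

-- Colourings with kernel-perfect colour classes

module _ (D : Digraph N) where

  abstract

    -- The vertices of colour i.  The definition is abstract so that c and i can
    -- be inferred from class c i.
    class : (Fin N → Fin k) → Fin k → Subset N
    class c i = subsetOf (λ u → u ∈? V D ×-dec c u ≟ i)

    ∈class⁺ : ∀ {c : Fin N → Fin k} {i u} → u ∈ V D → c u ≡ i → u ∈ class c i
    ∈class⁺ {c = c} {i} u∈V cu≡i =
      ∈-subsetOf⁺ (λ u → u ∈? V D ×-dec c u ≟ i) (u∈V , cu≡i)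

    ∈class⁻ : ∀ {c : Fin N → Fin k} {i u} → u ∈ class c i → u ∈ V D × c u ≡ i
    ∈class⁻ {c = c} {i} = ∈-subsetOf⁻ (λ u → u ∈? V D ×-dec c u ≟ i)

  class⊆V : ∀ {c : Fin N → Fin k} {i} → class c i ⊆ V D
  class⊆V {c = c} {i} u∈ = proj₁ (∈class⁻ {c = c} {i} u∈)

  -- A partition of V D into k kernel-perfect sets, some of which may be empty;
  -- the colours of labels outside V D are irrelevant.
  PerfectColouring : (Fin N → Fin k) → Set
  PerfectColouring c = ∀ i → Perfect D (class c i)

  partition⇒colouring : ∀ {m} .{{_ : NonZero k}} → m ℕ.≤ k → KernelPerfectPartition D m →
                        ∃ (PerfectColouring {k = k})
  partition⇒colouring {k = k} m≤k partition = c , perfect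
    where
    open KernelPerfectPartition partition

    colour : ∀ {u} → Dec (u ∈ V D) → Fin k
    colour (yes u∈V) = inject≤ (proj₁ (cover u∈V)) m≤k
    colour (no _)    = fromℕ< (ℕ.>-nonZero⁻¹ k)

    c : Fin N → Fin k
    c u = colour (u ∈? V D)

    part∋ : ∀ {u} → u ∈ V D → ∃[ i ] u ∈ part i × c u ≡ inject≤ i m≤k
    part∋ {u} u∈V with u ∈? V D
    ... | yes p  = proj₁ (cover p) , proj₂ (cover p) , refl
    ... | no u∉V = contradiction u∈V u∉V

    perfect : PerfectColouring c
    perfect j with nonempty? (class c j)
    ... | no empty = independent⇒perfect D (λ u∈ → contradiction (_ , u∈) empty)
    ... | yes (w , w∈) with part∋ (proj₁ (∈class⁻ w∈))
    ...   | i , _ , cw≡i =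
      perfect-⊆ D class⊆part (kernelPerfect⇒perfect D (part⊆V i) (kernelPerfect i))
      where
      class⊆part : class c j ⊆ part i
      class⊆part u∈ with part∋ (proj₁ (∈class⁻ u∈))
      ... | i′ , u∈part , cu≡i′ = subst (λ i → _ ∈ part i)
        (inject≤-injective m≤k m≤k i′ i
          (trans (sym cu≡i′) (trans (proj₂ (∈class⁻ u∈)) (trans (sym (proj₂ (∈class⁻ w∈))) cw≡i))))
        u∈part

  classAbsorber : ∀ {c : Fin N → Fin k} → PerfectColouring c →
                  ∀ i → ∃[ Q ] Absorber D (V D) (class c i) Q
  classAbsorber {c = c} perfect i = absorber D (class⊆V {c = c} {i}) (perfect i)

  -- u is a vertex all of whose out-neighbours have the colour of u.
  Bad : (Fin N → Fin k) → Pred (Fin N) 0ℓ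
  Bad c u = u ∈ V D × (∀ v → Arc D u v → c v ≡ c u)

  bad? : (c : Fin N → Fin k) → Decidable (Bad c)
  bad? c u = u ∈? V D ×-dec all? (λ v → arc? D u v →-dec c v ≟ c u)

  crossing : ∀ {c : Fin N → Fin k} {u} → u ∈ V D → ¬ Bad c u → ∃[ v ] Arc D u v × c v ≢ c u
  crossing {c = c} {u} u∈V ¬bad with any? (λ v → arc? D u v ×-dec ¬? (c v ≟ c u))
  ... | yes found = found
  ... | no none = contradiction
    (u∈V , λ v a → decidable-stable (c v ≟ c u) (λ cv≢cu → none (v , a , cv≢cu))) ¬bad

  badIn? : (c : Fin N → Fin k) (i : Fin k) → Decidable (λ u → Bad c u × c u ≡ i)
  badIn? c i u = bad? c u ×-dec c u ≟ i

  badKernel : ∀ {c : Fin N → Fin k} → PerfectColouring c →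
              ∀ i → ∃[ M ] KernelIn D (subsetOf (badIn? c i)) M
  badKernel {c = c} perfect i = perfect i (subsetOf (badIn? c i)) λ u∈ →
    let (u∈V , _) , cu≡i = ∈-subsetOf⁻ (badIn? c i) u∈ in ∈class⁺ u∈V cu≡i

  -- The bad vertices all have colour zero.
  BadOnlyZero : (Fin N → Fin (suc k)) → Set
  BadOnlyZero c = ∀ {u} → Bad c u → c u ≡ zero

  -- For every nonzero colour i a kernel M i of the bad vertices of colour i
  -- receives colour zero.  Let u still have colour i afterwards.  If u was bad,
  -- it has an out-neighbour in M i, which now has colour zero; otherwise it had
  -- an out-neighbour of a colour other than i, and still has, since the only
  -- new colour is zero.
  recolour : (c : Fin N → Fin (suc k)) → PerfectColouring c →
             ∃[ c′ ] PerfectColouring {k = suc k} c′ × BadOnlyZero c′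
  recolour {k = k} c perfect = c′ , perfect′ , badOnlyZero
    where
    M : Fin (suc k) → Subset N
    M i = proj₁ (badKernel perfect i)

    M-bad : ∀ {i u} → u ∈ M i → Bad c u × c u ≡ i
    M-bad {i} u∈M = ∈-subsetOf⁻ (badIn? c i) (proj₁ (proj₂ (badKernel perfect i)) u∈M)

    moves? : Decidable (λ u → u ∈ M (c u) × c u ≢ zero)
    moves? u = u ∈? M (c u) ×-dec ¬? (c u ≟ zero)

    -- The vertices that move to colour zero.
    L = subsetOf moves?

    c′ : Fin N → Fin (suc k)
    c′ u with u ∈? L
    ... | yes _ = zero
    ... | no _  = c u

    c′-moved : ∀ {u} → u ∈ L → c′ u ≡ zero
    c′-moved {u} u∈L with u ∈? L
    ... | yes _  = refl
    ... | no u∉L = contradiction u∈L u∉L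

    c′-fixed : ∀ {u} → u ∉ L → c′ u ≡ c u
    c′-fixed {u} u∉L with u ∈? L
    ... | yes u∈L = contradiction u∈L u∉L
    ... | no _    = refl

    c′≢0⇒u∉L : ∀ {u} → c′ u ≢ zero → u ∉ L
    c′≢0⇒u∉L c′u≢0 u∈L = c′u≢0 (c′-moved u∈L)

    indepL : Independent D L
    indepL {u} {v} u∈L v∈L a =
      let u∈M , _ = ∈-subsetOf⁻ moves? u∈L
          v∈M , _ = ∈-subsetOf⁻ moves? v∈L
          cv≡cu   = proj₂ (proj₁ (M-bad u∈M)) v a
      in proj₁ (proj₂ (proj₂ (badKernel perfect (c u))))
           u∈M (subst (λ i → v ∈ M i) cv≡cu v∈M) a

    L↛class₀ : ∀ {u v} → u ∈ L → v ∈ class c zero → ¬ Arc D u v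
    L↛class₀ {u} {v} u∈L v∈₀ a =
      let u∈M , cu≢0 = ∈-subsetOf⁻ moves? u∈L
      in cu≢0 (trans (sym (proj₂ (proj₁ (M-bad u∈M)) v a)) (proj₂ (∈class⁻ v∈₀)))

    perfect′ : PerfectColouring c′
    perfect′ zero = perfect-⊆ D class₀⊆ (perfect-∪-sinks D (perfect zero) indepL L↛class₀)
      where
      class₀⊆ : class c′ zero ⊆ class c zero ∪ L
      class₀⊆ {u} u∈ with u ∈? L
      ... | yes u∈L = x∈p∪q⁺ (inj₂ u∈L)
      ... | no u∉L  = let u∈V , c′u≡0 = ∈class⁻ u∈ in
        x∈p∪q⁺ (inj₁ (∈class⁺ u∈V (trans (sym (c′-fixed u∉L)) c′u≡0)))
    perfect′ (suc i) = perfect-⊆ D class⊆ (perfect (suc i))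
      where
      class⊆ : class c′ (suc i) ⊆ class c (suc i)
      class⊆ u∈ =
        let u∈V , c′u≡i = ∈class⁻ u∈
            u∉L = c′≢0⇒u∉L (λ c′u≡0 → case trans (sym c′u≡0) c′u≡i of λ ())
        in ∈class⁺ u∈V (trans (sym (c′-fixed u∉L)) c′u≡i)

    badOnlyZero : BadOnlyZero c′
    badOnlyZero {u} (u∈V , bad′) with c′ u ≟ zero
    ... | yes c′u≡0 = c′u≡0
    ... | no c′u≢0 = ⊥-elim (impossible (bad? c u))
      where
      u∉L = c′≢0⇒u∉L c′u≢0

      cu≢0 : c u ≢ zero
      cu≢0 cu≡0 = c′u≢0 (trans (c′-fixed u∉L) cu≡0)

      u↛L : ∀ {v} → v ∈ L → ¬ Arc D u v
      u↛L {v} v∈L a = c′u≢0 (trans (sym (bad′ v a)) (c′-moved v∈L))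

      impossible : ¬ Dec (Bad c u)
      impossible (yes bad)
        with proj₂ (proj₂ (proj₂ (badKernel perfect (c u))))
               (∈-subsetOf⁺ (badIn? c (c u)) (bad , refl))
      ... | inj₁ u∈M = u∉L (∈-subsetOf⁺ moves? (u∈M , cu≢0))
      ... | inj₂ (v , v∈M , a) = u↛L (∈-subsetOf⁺ moves?
        ( subst (λ i → v ∈ M i) (sym (proj₂ bad v a)) v∈M
        , λ cv≡0 → cu≢0 (trans (sym (proj₂ bad v a)) cv≡0))) a
      impossible (no ¬bad) with crossing u∈V ¬bad
      ... | v , a , cv≢cu with v ∈? L
      ...   | yes v∈L = u↛L v∈L a
      ...   | no v∉L  = cv≢cu (trans (sym (c′-fixed v∉L)) (trans (bad′ v a) (c′-fixed u∉L)))

-- Quasi-kernels without a common vertex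

module _ (D : Digraph N) (sinkFree : SinkFree D) where

  outNeighbour : ∀ {u} → u ∈ V D → ∃[ v ] Arc D u v
  outNeighbour {u} u∈V with any? (arc? D u)
  ... | yes found = found
  ... | no none   = contradiction (u∈V , λ v a → none (v , a)) (sinkFree u)

  module Targets {k} (c : Fin N → Fin (suc (suc k))) (perfect : PerfectColouring D c)
                 (badOnlyZero : BadOnlyZero D c) where

    B : Subset N
    B = subsetOf (bad? D c)

    kernelB : ∃[ M ] KernelIn D B M
    kernelB = perfect zero B λ u∈B →
      let bad = ∈-subsetOf⁻ (bad? D c) u∈B in ∈class⁺ D (proj₁ bad) (badOnlyZero bad)

    M : Subset N
    M = proj₁ kernelB

    M-bad : ∀ {u} → u ∈ M → Bad D c u
    M-bad u∈M = ∈-subsetOf⁻ (bad? D c) (proj₁ (proj₂ kernelB) u∈M)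

    indepM : Independent D M
    indepM = proj₁ (proj₂ (proj₂ kernelB))

    B→M : ∀ {u} → Bad D c u → Reach₁ D M u
    B→M bad = proj₂ (proj₂ (proj₂ kernelB)) (∈-subsetOf⁺ (bad? D c) bad)

    c[M]≡0 : ∀ {u} → u ∈ M → c u ≡ zero
    c[M]≡0 u∈M = badOnlyZero (M-bad u∈M)

    -- The sets to be absorbed.  They overlap in M, but every vertex of V D has
    -- an out-neighbour in some T i that does not contain it, up to the
    -- exception named in avoided.
    T : Fin (suc (suc k)) → Subset N
    T zero    = class D c zero ─ M
    T (suc i) = class D c (suc i) ∪ M

    M↛class : ∀ {i u v} → u ∈ M → v ∈ class D c (suc i) → ¬ Arc D u v
    M↛class {v = v} u∈M v∈ a =
      case trans (sym (proj₂ (∈class⁻ D v∈))) (trans (proj₂ (M-bad u∈M) v a) (c[M]≡0 u∈M)) of λ ()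

    T⊆V : ∀ i → T i ⊆ V D
    T⊆V zero u∈ = class⊆V D {c = c} {zero} (p─q⊆p (class D c zero) M u∈)
    T⊆V (suc i) u∈ with x∈p∪q⁻ (class D c (suc i)) M u∈
    ... | inj₁ u∈class = class⊆V D {c = c} {suc i} u∈class
    ... | inj₂ u∈M     = proj₁ (M-bad u∈M)

    T-perfect : ∀ i → Perfect D (T i)
    T-perfect zero    = perfect-⊆ D (p─q⊆p (class D c zero) M) (perfect zero)
    T-perfect (suc i) = perfect-∪-sinks D (perfect (suc i)) indepM M↛class

    u∉T : ∀ {u} i → c u ≢ i → u ∉ M → u ∉ T i
    u∉T zero cu≢0 _ u∈T = cu≢0 (proj₂ (∈class⁻ D (p─q⊆p (class D c zero) M u∈T)))
    u∉T (suc i) cu≢i u∉M u∈T with x∈p∪q⁻ (class D c (suc i)) M u∈T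
    ... | inj₁ u∈class = cu≢i (proj₂ (∈class⁻ D u∈class))
    ... | inj₂ u∈M     = u∉M u∈M

    -- If each Q i absorbs T i, no vertex lies in all Q i, provided that this
    -- holds for the vertices of nonzero colour with an out-neighbour in M.
    avoided : (Q : Fin (suc (suc k)) → Subset N) → (∀ i → Absorber D (V D) (T i) (Q i)) →
              (∀ {u} → c u ≢ zero → Hits D M u → ∃[ i ] u ∉ Q i) →
              ∀ {u} → u ∈ V D → ∃[ i ] u ∉ Q i
    avoided Q absorbs special {u} u∈V = split (u ∈? M) (bad? D c u)
      where
      by : ∀ {v} i → v ∈ T i → Arc D u v → u ∉ T i → ∃[ i ] u ∉ Q i
      by {v} i v∈T a u∉Tᵢ = i , λ u∈Q → u∉Tᵢ (Absorber.avoid (absorbs i) u∈Q (v , v∈T , a))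

      split : Dec (u ∈ M) → Dec (Bad D c u) → ∃[ i ] u ∉ Q i
      split (yes u∈M) _ =
        let v , a = outNeighbour u∈V
            cv≡0  = trans (proj₂ (M-bad u∈M) v a) (c[M]≡0 u∈M)
        in by zero
             (x∈p∧x∉q⇒x∈p─q (∈class⁺ D (proj₂ (endpoints D a)) cv≡0) (λ v∈M → indepM u∈M v∈M a))
             a (λ u∈T → x∈p─q⇒x∉q (class D c zero) M u∈T u∈M)
      split (no u∉M) (yes bad) with B→M bad
      ... | inj₁ u∈M = contradiction u∈M u∉M
      ... | inj₂ (v , v∈M , a) = by (suc zero) (x∈p∪q⁺ (inj₂ v∈M)) a
        (u∉T (suc zero) (λ cu≡1 → case trans (sym (badOnlyZero bad)) cu≡1 of λ ()) u∉M)
      split (no u∉M) (no ¬bad) with crossing D u∈V ¬bad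
      ... | v , a , cv≢cu with v ∈? M
      ...   | yes v∈M = special (λ cu≡0 → cv≢cu (trans (c[M]≡0 v∈M) (sym cu≡0))) (v , v∈M , a)
      ...   | no v∉M  = by (c v) (v∈T (c v) refl) a (u∉T (c v) (cv≢cu ∘ sym) u∉M)
        where
        v∈T : ∀ i → c v ≡ i → v ∈ T i
        v∈T zero    cv≡0 = x∈p∧x∉q⇒x∈p─q (∈class⁺ D (proj₂ (endpoints D a)) cv≡0) v∉M
        v∈T (suc i) cv≡i = x∈p∪q⁺ (inj₁ (∈class⁺ D (proj₂ (endpoints D a)) cv≡i))

  -- A family of quasi-kernels of D with empty intersection.
  NoCommonVertex : ∀ {k} → (Fin k → Subset N) → Set
  NoCommonVertex Q = (∀ i → QuasiKernelIn D (V D) (Q i)) × (∀ {u} → u ∈ V D → ∃[ i ] u ∉ Q i)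

  noCommonVertex : ∀ k (c : Fin N → Fin (suc (suc k))) → PerfectColouring D c →
                   BadOnlyZero D c → ∃ (NoCommonVertex {suc (suc k)})
  noCommonVertex zero c perfect badOnlyZero =
    Q , (λ i → Absorber.quasiKernel (absorbs i)) , avoided Q absorbs special
    where
    open Targets c perfect badOnlyZero

    T₁ : Subset N
    T₁ = T (suc zero)

    Q₀ = absorber D (T⊆V zero) (T-perfect zero)

    -- The vertices of M are sinks in T₁, so this kernel contains them all.
    K₁ = kernel-∪-sinks D (perfect (suc zero)) indepM M↛class {S′ = T₁} (λ u∈ → u∈)

    Q : Fin 2 → Subset N
    Q zero       = proj₁ Q₀
    Q (suc zero) = proj₁ K₁

    M⊆Q₁ : M ⊆ Q (suc zero)
    M⊆Q₁ u∈M = proj₂ (proj₂ K₁) (x∈p∩q⁺ (x∈p∪q⁺ (inj₂ u∈M) , u∈M))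

    -- T₁ consists of class 1 and M; a vertex of colour zero that is not bad has
    -- an out-neighbour of colour 1.
    V⊆N⁻[T₁] : ∀ {u} → u ∈ V D → Reach₁ D T₁ u
    V⊆N⁻[T₁] {u} u∈V = split (c u) refl
      where
      split : ∀ i → c u ≡ i → Reach₁ D T₁ u
      split (suc zero) cu≡1 = inj₁ (x∈p∪q⁺ (inj₁ (∈class⁺ D u∈V cu≡1)))
      split zero cu≡0 with bad? D c u
      ... | yes bad with B→M bad
      ...   | inj₁ u∈M = inj₁ (x∈p∪q⁺ (inj₂ u∈M))
      ...   | inj₂ (v , v∈M , a) = inj₂ (v , x∈p∪q⁺ (inj₂ v∈M) , a)
      split zero cu≡0 | no ¬bad with crossing D u∈V ¬bad
      ...   | v , a , cv≢cu with c v in cv≡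
      ...     | zero     = contradiction (sym cu≡0) cv≢cu
      ...     | suc zero = inj₂ (v , x∈p∪q⁺ (inj₁ (∈class⁺ D (proj₂ (endpoints D a)) cv≡)) , a)

    absorbs : ∀ i → Absorber D (V D) (T i) (Q i)
    absorbs zero       = proj₂ Q₀
    absorbs (suc zero) = kernel⇒absorber D (T⊆V (suc zero)) V⊆N⁻[T₁]
                           (proj₁ (proj₂ K₁))

    special : ∀ {u} → c u ≢ zero → Hits D M u → ∃[ i ] u ∉ Q i
    special _ (v , v∈M , a) = suc zero , λ u∈Q₁ →
      proj₁ (proj₂ (proj₁ (proj₂ K₁))) u∈Q₁ (M⊆Q₁ v∈M) a
  noCommonVertex (suc k) c perfect badOnlyZero =
    Q , (λ i → Absorber.quasiKernel (absorbs i)) , avoided Q absorbs special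
    where
    open Targets c perfect badOnlyZero

    Q′ : ∀ i → ∃[ Q ] Absorber D (V D) (T i) Q
    Q′ i = absorber D (T⊆V i) (T-perfect i)

    Q = λ i → proj₁ (Q′ i)
    absorbs = λ i → proj₂ (Q′ i)

    -- A nonzero colour different from i: colour 1, or colour 2 if i is 1.
    otherColour : ∀ i → ∃[ j ] i ≢ suc j
    otherColour (suc zero) = suc zero , λ ()
    otherColour zero = zero , λ ()
    otherColour (suc (suc _)) = zero , λ ()

    special : ∀ {u} → c u ≢ zero → Hits D M u → ∃[ i ] u ∉ Q i
    special {u} cu≢0 (v , v∈M , a) =
      let j , cu≢j = otherColour (c u) in suc j , λ u∈Q →
      u∉T (suc j) cu≢j (λ u∈M → cu≢0 (c[M]≡0 u∈M))
        (Absorber.avoid (absorbs (suc j)) u∈Q (v , x∈p∪q⁺ (inj₂ v∈M) , a))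

  missManyVertices : 2 ℕ.≤ k → (c : Fin N → Fin k) → PerfectColouring D c →
                     ∃[ Q ] QuasiKernelIn D (V D) Q × ∣ V D ∣ ℕ.≤ k ℕ.* ∣ V D ─ Q ∣
  missManyVertices {k = suc (suc k)} (s≤s (s≤s _)) c perfect =
    let c′ , perfect′ , badOnlyZero = recolour D c perfect
        Q , quasi , avoids = noCommonVertex k c′ perfect′ badOnlyZero
        i , large = cover⇒large (V D) (λ i → V D ─ Q i) λ u∈V →
          let i , u∉Q = avoids u∈V in i , x∈p∧x∉q⇒x∈p─q u∈V u∉Q
    in Q i , quasi i , large

-- Quasi-kernels from the absorption of a single class

module _ (D : Digraph N) where

  sourceInto? : ∀ S → Decidable (λ u → Source D u × Hits D S u)
  sourceInto? S u = source? D u ×-dec hits? D S u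

  -- A deleted source u has an out-neighbour v in S, and v or an out-neighbour of
  -- v lies in Q; that vertex has an in-neighbour, so it is not deleted itself.
  dropSources : ∀ {S Q} → Absorber D (V D) S Q →
                QuasiKernelIn D (V D) (Q ─ subsetOf (sourceInto? S))
  dropSources {S} {Q} absorbs = record
    { sub   = sub ∘ p─q⊆p Q X
    ; indep = λ u∈ v∈ → indep (p─q⊆p Q X u∈) (p─q⊆p Q X v∈)
    ; reach = λ u∈V → keep (reach u∈V) }
    where
    open Absorber absorbs
    X = subsetOf (sourceInto? S)

    keep₁ : ∀ {u v} → Arc D u v → Reach₁ D Q v → Reach₁ D (Q ─ X) v
    keep₁ {u} {v} a (inj₁ v∈Q) = inj₁ (x∈p∧x∉q⇒x∈p─q v∈Q λ v∈X →
      proj₂ (proj₁ (∈-subsetOf⁻ (sourceInto? S) v∈X)) u a)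
    keep₁ {v = v} a (inj₂ (w , w∈Q , b)) = inj₂ (w , x∈p∧x∉q⇒x∈p─q w∈Q (λ w∈X →
      proj₂ (proj₁ (∈-subsetOf⁻ (sourceInto? S) w∈X)) v b) , b)

    keep : ∀ {u} → Reach₂ D Q u → Reach₂ D (Q ─ X) u
    keep (inj₂ (v , a , r)) = inj₂ (v , a , keep₁ a r)
    keep (inj₁ (inj₂ (v , v∈Q , a))) = inj₂ (v , a , keep₁ a (inj₁ v∈Q))
    keep {u} (inj₁ (inj₁ u∈Q)) with u ∈? X
    ... | no u∉X = inj₁ (inj₁ (x∈p∧x∉q⇒x∈p─q u∈Q u∉X))
    ... | yes u∈X with ∈-subsetOf⁻ (sourceInto? S) u∈X
    ...   | _ , v , v∈S , a = inj₂ (v , a , keep₁ a (near v∈S))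

  missManySources : .{{_ : NonZero k}} (c : Fin N → Fin k) → PerfectColouring D c →
    ∃[ Q ] QuasiKernelIn D (V D) Q × ∣ nonSinkSources D ∣ ℕ.≤ k ℕ.* ∣ V D ─ Q ∣
  missManySources {k = k} c perfect =
    let i , large = cover⇒large (nonSinkSources D) X covered
        Q , absorbs = classAbsorber D perfect i
    in Q ─ X i , dropSources absorbs
       , ℕ.≤-trans large (ℕ.*-monoʳ-≤ k (p⊆q⇒∣p∣≤∣q∣ (X⊆V─ Q)))
    where
    X : Fin k → Subset N
    X i = subsetOf (sourceInto? (class D c i))

    covered : ∀ {u} → u ∈ nonSinkSources D → ∃[ i ] u ∈ X i
    covered {u} u∈ with ∈-subsetOf⁻ (λ u → source? D u ×-dec ¬? (sink? D u)) u∈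
    ... | source , ¬sink with any? (arc? D u)
    ...   | no none = contradiction (proj₁ source , λ v a → none (v , a)) ¬sink
    ...   | yes (v , a) = c v , ∈-subsetOf⁺ (sourceInto? (class D c (c v)))
      (source , v , ∈class⁺ D (proj₂ (endpoints D a)) refl , a)

    X⊆V─ : ∀ Q {i} → X i ⊆ V D ─ (Q ─ X i)
    X⊆V─ Q {i} u∈X = x∈p∧x∉q⇒x∈p─q
      (proj₁ (proj₁ (∈-subsetOf⁻ (sourceInto? (class D c i)) u∈X)))
      (λ u∈ → x∈p─q⇒x∉q Q (X i) u∈ u∈X)

  absorbManyVertices : .{{_ : NonZero k}} (c : Fin N → Fin k) → PerfectColouring D c →
    ∃[ Q ] QuasiKernelIn D (V D) Q × ∣ V D ∣ ℕ.≤ k ℕ.* ∣ N⁻[_] D Q ∣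
  absorbManyVertices {k = k} c perfect =
    let i , large = cover⇒large (V D) (class D c) (λ {u} u∈V → c u , ∈class⁺ D u∈V refl)
        Q , absorbs = classAbsorber D perfect i
    in Q , Absorber.quasiKernel absorbs
       , ℕ.≤-trans large (ℕ.*-monoʳ-≤ k (p⊆q⇒∣p∣≤∣q∣ λ u∈ →
           ∈N⁻⁺ D (class⊆V D {c = c} {i} u∈) (Absorber.near absorbs u∈)))

-- Rational bounds

toℚᵘ-/ : ∀ n k → toℚᵘ (+ n / suc k) ℚᵘ.≃ mkℚᵘ (+ n) k
toℚᵘ-/ n k = toℚᵘ-fromℚᵘ (mkℚᵘ (+ n) k)

n≤k*m⇒n/k≤m : ∀ n k m .{{_ : NonZero k}} → n ℕ.≤ k ℕ.* m → + n / k ≤ + m / 1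
n≤k*m⇒n/k≤m n (suc k) m n≤k*m = toℚᵘ-cancel-≤ (begin
  toℚᵘ (+ n / suc k) ≃⟨ toℚᵘ-/ n k ⟩
  mkℚᵘ (+ n) k       ≤⟨ *≤* crossed ⟩
  mkℚᵘ (+ m) 0       ≃⟨ toℚᵘ-/ m 0 ⟨
  toℚᵘ (+ m / 1)     ∎)
  where
  open ℚᵘ.≤-Reasoning
  crossed : + n ℤ.* + 1 ℤ.≤ + m ℤ.* + suc k
  crossed rewrite sym (ℤ.pos-* n 1) | sym (ℤ.pos-* m (suc k)) =
    ℤ.+≤+ (ℕ.≤-trans (ℕ.≤-reflexive (ℕ.*-identityʳ n))
      (ℕ.≤-trans n≤k*m (ℕ.≤-reflexive (ℕ.*-comm (suc k) m))))

+-/1 : ∀ m n → + (m ℕ.+ n) / 1 ≡ (+ m / 1) ℚ.+ (+ n / 1)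
+-/1 m n = toℚᵘ-injective (begin-equality
  toℚᵘ (+ (m ℕ.+ n) / 1)                  ≃⟨ toℚᵘ-/ (m ℕ.+ n) 0 ⟩
  mkℚᵘ (+ (m ℕ.+ n)) 0                    ≃⟨ *≡* crossed ⟩
  mkℚᵘ (+ m) 0 ℚᵘ.+ mkℚᵘ (+ n) 0          ≃⟨ ℚᵘ.+-cong (toℚᵘ-/ m 0) (toℚᵘ-/ n 0) ⟨
  toℚᵘ (+ m / 1) ℚᵘ.+ toℚᵘ (+ n / 1)      ≃⟨ toℚᵘ-homo-+ (+ m / 1) (+ n / 1) ⟨
  toℚᵘ ((+ m / 1) ℚ.+ (+ n / 1))          ∎)
  where
  open ℚᵘ.≤-Reasoning
  crossed : + (m ℕ.+ n) ℤ.* + 1 ≡ (+ m ℤ.* + 1 ℤ.+ + n ℤ.* + 1) ℤ.* + 1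
  crossed = cong (ℤ._* + 1) (cong₂ ℤ._+_ (sym (ℤ.*-identityʳ (+ m))) (sym (ℤ.*-identityʳ (+ n))))

1/k*n≡n/k : ∀ k n .{{_ : NonZero k}} → (+ 1 / k) * (+ n / 1) ≡ + n / k
1/k*n≡n/k (suc k) n = toℚᵘ-injective (begin-equality
  toℚᵘ ((+ 1 / suc k) * (+ n / 1))          ≃⟨ toℚᵘ-homo-* (+ 1 / suc k) (+ n / 1) ⟩
  toℚᵘ (+ 1 / suc k) ℚᵘ.* toℚᵘ (+ n / 1)    ≃⟨ ℚᵘ.*-cong (toℚᵘ-/ 1 k) (toℚᵘ-/ n 0) ⟩
  mkℚᵘ (+ 1) k ℚᵘ.* mkℚᵘ (+ n) 0            ≃⟨ *≡* crossed ⟩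
  mkℚᵘ (+ n) k                              ≃⟨ toℚᵘ-/ n k ⟨
  toℚᵘ (+ n / suc k)                        ∎)
  where
  open ℚᵘ.≤-Reasoning
  crossed : (+ 1 ℤ.* + n) ℤ.* + suc k ≡ + n ℤ.* + (suc k ℕ.* 1)
  crossed = cong₂ ℤ._*_ (ℤ.*-identityˡ (+ n)) (cong +_ (sym (ℕ.*-identityʳ (suc k))))

complement-bound : ∀ {n q m x} k .{{_ : NonZero k}} → q ℕ.+ m ≡ n → x ℕ.≤ k ℕ.* m →
                   + q / 1 ≤ + n / 1 - + x / k
complement-bound {n} {q} {m} {x} k refl x≤k*m = begin
  + q / 1                                     ≡⟨ ℚ.+-identityʳ (+ q / 1) ⟨
  (+ q / 1) ℚ.+ ℚ.0ℚ                          ≡⟨ cong ((+ q / 1) ℚ.+_) (ℚ.+-inverseʳ (+ m / 1)) ⟨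
  (+ q / 1) ℚ.+ ((+ m / 1) - (+ m / 1))       ≡⟨ ℚ.+-assoc (+ q / 1) (+ m / 1) _ ⟨
  ((+ q / 1) ℚ.+ (+ m / 1)) - (+ m / 1)       ≡⟨ cong (_- (+ m / 1)) (+-/1 q m) ⟨
  + (q ℕ.+ m) / 1 - + m / 1
    ≤⟨ +-monoʳ-≤ (+ (q ℕ.+ m) / 1) (neg-antimono-≤ (n≤k*m⇒n/k≤m x k m x≤k*m)) ⟩
  + (q ℕ.+ m) / 1 - + x / k                   ∎
  where open ℚ.≤-Reasoning

[1-1/k]*n≡n-n/k : ∀ k n .{{_ : NonZero k}} → (1ℚ - + 1 / k) * (+ n / 1) ≡ + n / 1 - + n / k
[1-1/k]*n≡n-n/k k n = begin
  (1ℚ - + 1 / k) * (+ n / 1)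
    ≡⟨ *-distribʳ-+ (+ n / 1) 1ℚ (ℚ.- (+ 1 / k)) ⟩
  1ℚ * (+ n / 1) ℚ.+ (ℚ.- (+ 1 / k)) * (+ n / 1)
    ≡⟨ cong₂ ℚ._+_ (*-identityˡ (+ n / 1)) (sym (neg-distribˡ-* (+ 1 / k) (+ n / 1))) ⟩
  + n / 1 - (+ 1 / k) * (+ n / 1)
    ≡⟨ cong (λ x → + n / 1 - x) (1/k*n≡n/k k n) ⟩
  + n / 1 - + n / k ∎
  where open ≡-Reasoning

theorem1p9 :
    ∀ {N : ℕ} (D : Digraph N) (kp : ℕ) → KernelPerfectNumber D kp →
    let n = ∣ V D ∣
        k = kp ⊔ 2
        s = ∣ nonSinkSources D ∣
    in
      (SinkFree D →
        ∃[ Q ] QuasiKernel D Q × + ∣ Q ∣ / 1 ≤ (1ℚ - + 1 / k) * (+ n / 1))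
      × (∃[ Q ] QuasiKernel D Q × + ∣ Q ∣ / 1 ≤ + n / 1 - + s / k)
      × (∃[ Q ] QuasiKernel D Q × + ∣ N⁻[_] D Q ∣ / 1 ≥ + n / k)
theorem1p9 D kp (partition , _) = part-I , part-II , part-III
  where
  n = ∣ V D ∣
  κ = kp ⊔ 2
  s = ∣ nonSinkSources D ∣

  colouring = partition⇒colouring D (ℕ.m≤m⊔n kp 2) partition
  c = proj₁ colouring
  perfect = proj₂ colouring

  part-I : SinkFree D →
    ∃[ Q ] QuasiKernel D Q × + ∣ Q ∣ / 1 ≤ (1ℚ - + 1 / κ) * (+ n / 1)
  part-I sinkFree =
    let Q , quasi , large = missManyVertices D sinkFree (ℕ.m≤n⊔m kp 2) c perfect
    in Q , quasiKernelIn⇒quasiKernel D quasi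
       , subst (+ ∣ Q ∣ / 1 ≤_) (sym ([1-1/k]*n≡n-n/k κ n))
           (complement-bound κ (q⊆p⇒∣q∣+∣p─q∣≡∣p∣ (QuasiKernelIn.sub quasi)) large)

  part-II : ∃[ Q ] QuasiKernel D Q × + ∣ Q ∣ / 1 ≤ + n / 1 - + s / κ
  part-II =
    let Q , quasi , large = missManySources D c perfect
    in Q , quasiKernelIn⇒quasiKernel D quasi
       , complement-bound κ (q⊆p⇒∣q∣+∣p─q∣≡∣p∣ (QuasiKernelIn.sub quasi)) large

  part-III : ∃[ Q ] QuasiKernel D Q × + ∣ N⁻[_] D Q ∣ / 1 ≥ + n / κ
  part-III =
    let Q , quasi , large = absorbManyVertices D c perfect
    in Q , quasiKernelIn⇒quasiKernel D quasi
       , n≤k*m⇒n/k≤m n κ ∣ N⁻[_] D Q ∣ large
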